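{- Let $\mathcal{N}=(Q,Act,\delta)$ be a one-counter net and let $(p,q)\in Q\times Q$ be such that the frontier function $f_{\langle p,q\rangle}$ satisfies: $f_{\langle p,q\rangle}(n)\neq\infty$ for all $n\in\mathbb{N}$, and there is no $c\in\mathbb{N}$ with $f_{\langle p,q\rangle}(n)<c$ for all $n\in\mathbb{N}$. Then there are $\alpha\in\mathbb{Q}_+$ (a positive rational) and $c\in\mathbb{N}$ such that $|f_{\langle p,q\rangle}(n)-\alpha\cdot n|\leq c$ for all $n\in\mathbb{N}$.
   Context: A one-counter net is $\mathcal{N}=(Q,Act,\delta)$ with finite $Q$, $Act$ and rules $\delta\subseteq Q\times Act\times\{ -1,0,1\}\times Q$; its LTS has states $q(m)\in Q\times\mathbb{N}$ with $q(m)\xrightarrow{a}q'(n)$ iff $(q,a,n-m,q')\in\delta$. $\preceq$ is simulation preorder on this LTS (union of all simulations). For $(p,q)\in Q\times Q$ the frontier function $f_{\langle p,q\rangle}:\mathbb{N}\to\mathbb{N}\cup\{ -1,\infty\}$ is: $f_{\langle p,q\rangle}(n)=\infty$ if $p(m)\preceq q(n)$ for all $m\in\mathbb{N}$; $f_{\langle p,q\rangle}(n)=-1$ if $p(0)\not\preceq q(n)$; and $f_{\langle p,q\rangle}(n)=\max\{m\in\mathbb{N}\mid p(m)\preceq q(n)\}$ otherwise. -}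

module Defs where

open import Data.Nat as ℕ using (ℕ; zero; suc; _<_; _≤_)
open import Data.Fin using (Fin)
open import Data.List using (List)
open import Data.List.Membership.Propositional using (_∈_)
open import Data.Product using (Σ; ∃; _×_; _,_)
open import Data.Empty using (⊥)
open import Data.Unit using (⊤)
open import Relation.Binary.PropositionalEquality using (_≡_)
open import Relation.Nullary using (¬_)
open import Data.Integer as ℤ using (+_; -[1+_])
open import Data.Rational as ℚ using (ℚ)

data Effect : Set where
  dec stay inc : Effect

Applies : Effect → ℕ → ℕ → Set
Applies dec  m n = m ≡ suc n
Applies stay m n = n ≡ m
Applies inc  m n = n ≡ suc m

record OCN : Set where
  field
    nQ nA : ℕ
    δ     : List (Fin nQ × Fin nA × Effect × Fin nQ)

module _ (N : OCN) where
  open OCN N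

  Config : Set
  Config = Fin nQ × ℕ

  Step : Config → Fin nA → Config → Set
  Step (q , m) a (q' , n) = Σ Effect λ e → ((q , a , e , q') ∈ δ) × Applies e m n

  IsSimulation : (Config → Config → Set) → Set
  IsSimulation R = ∀ s t → R s t → ∀ a s' → Step s a s' →
                   Σ Config λ t' → Step t a t' × R s' t'

  _≼_ : Config → Config → Set₁
  s ≼ t = Σ (Config → Config → Set) λ R → IsSimulation R × R s t

  data ExtVal : Set where
    minus1 : ExtVal
    fin    : ℕ → ExtVal
    infty  : ExtVal

  IsFrontier : Fin nQ → Fin nQ → ℕ → ExtVal → Set₁
  IsFrontier p q n infty  = ∀ m → (p , m) ≼ (q , n)
  IsFrontier p q n minus1 = ¬ ((p , 0) ≼ (q , n))
  IsFrontier p q n (fin k) =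
    ((p , k) ≼ (q , n)) × (∀ m → (p , m) ≼ (q , n) → m ≤ k)

  FrontierFunction : Fin nQ → Fin nQ → (ℕ → ExtVal) → Set₁
  FrontierFunction p q f = ∀ n → IsFrontier p q n (f n)

  _<ₑ_ : ExtVal → ℕ → Set
  minus1 <ₑ c = ⊤
  fin k  <ₑ c = k < c
  infty  <ₑ c = ⊥

  DistLe : ExtVal → ℚ → ℕ → ℕ → Set
  DistLe minus1  α n c = ℚ.∣ (ℤ.-[1+ 0 ] ℚ./ 1) ℚ.- α ℚ.* ((+ n) ℚ./ 1) ∣ ℚ.≤ ((+ c) ℚ./ 1)
  DistLe (fin k) α n c = ℚ.∣ ((+ k) ℚ./ 1) ℚ.- α ℚ.* ((+ n) ℚ./ 1) ∣ ℚ.≤ ((+ c) ℚ./ 1)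
  DistLe infty   α n c = ⊥

{-# OPTIONS --safe #-}
module Submission where

-- For a direction σ consider the game on pairs of control states that is played until a
-- pair repeats; Duplicator wins if the cycle so closed does not lead to Spoiler's side of σ,
-- or if a pair is met from which she wins for a steeper direction.  This is a finite game.
-- Cutting out closed cycles and resuming the play, its winner also wins the simulation game
-- from all positions far enough on the winner's side: Duplicator stays below σ, while
-- Spoiler drifts away from σ until he is above the next steeper direction, where he wins by
-- induction.  In the meantime he stays above the next flatter direction, since the
-- directions are all multiples of 1 / l ! and so no short cycle points strictly between two
-- neighbours.  The slope α is the direction at which the winner changes.

open import Defs
open import Data.Nat as ℕ using (ℕ; zero; suc; z≤n; s≤s; NonZero; _!; _∸_)
import Data.Nat.Properties as ℕₚ
import Data.Nat.Divisibility as ℕ∣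
open import Data.Integer as ℤ using (ℤ; +_; -[1+_]; -_; _+_; _*_; _-_; _≤_; ∣_∣; 0ℤ; 1ℤ; -1ℤ; +≤+)
open import Data.Integer.Properties
open import Data.Integer.Tactic.RingSolver using (solve-∀)
open import Data.Rational as ℚ using (ℚ; Positive; toℚᵘ)
import Data.Rational.Properties as ℚₚ
open import Data.Rational.Unnormalised as ℚᵘ using (mkℚᵘ; *≤*)
import Data.Rational.Unnormalised.Properties as ℚᵘₚ
open import Data.Fin as Fin using (Fin)
import Data.Fin.Properties as Finₚ
open import Data.List using (List; []; _∷_; length; map; lookup)
open import Data.List.Properties using (length-map)
open import Data.List.Membership.Propositional using (_∈_; find; lose)
open import Data.List.Membership.Propositional.Properties using (∈-lookup)
open import Data.List.Relation.Unary.All as All using (All; []; _∷_)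
open import Data.List.Relation.Unary.All.Properties using (¬All⇒Any¬; ¬Any⇒All¬) renaming (map⁺ to All-map⁺)
open import Data.List.Relation.Unary.AllPairs using ([]; _∷_)
open import Data.List.Relation.Unary.Any as Any using (Any; here; there)
open import Data.List.Relation.Unary.Unique.Propositional using (Unique)
open import Data.Product using (Σ; ∃; _×_; _,_; proj₁; proj₂)
open import Data.Product.Properties using (≡-dec)
open import Data.Sum using (_⊎_; inj₁; inj₂; [_,_]′)
open import Data.Empty using (⊥)
open import Data.Unit using (⊤; tt)
open import Function using (_∘_; case_of_)
open import Relation.Binary.PropositionalEquality
open import Relation.Nullary using (¬_; contradiction; Dec; yes; no)
open import Relation.Nullary.Decidable using (_×-dec_; _⊎-dec_; _→-dec_; decidable-stable)
open import Relation.Unary using (Decidable)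

-- Displacements and their weight relative to a direction.

Vector : Set
Vector = ℤ × ℤ

infixl 6 _⊕_ _⊖ᵛ_

_⊕_ _⊖ᵛ_ : Vector → Vector → Vector
(a , b) ⊕ (c , d) = a + c , b + d
(a , b) ⊖ᵛ (c , d) = a - c , b - d

𝟎 : Vector
𝟎 = 0ℤ , 0ℤ

-- The direction (u , v) stands for the slope u / v; vectors of positive weight lie on
-- Spoiler's side of it.
weight : ℕ × ℕ → Vector → ℤ
weight (u , v) (a , b) = a * + v - b * + u

Bounded : ℕ → Vector → Set
Bounded l (a , b) = ∣ a ∣ ℕ.≤ l × ∣ b ∣ ℕ.≤ l

-- Reduces an inequality to a ring identity: `j - i` is rewritten as a visibly nonnegative
-- expression.
≤-by-difference : ∀ {i j d} → 0ℤ ≤ d → j - i ≡ d → i ≤ j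
≤-by-difference 0≤d eq = 0≤i-j⇒j≤i (subst (0ℤ ≤_) (sym eq) 0≤d)

0≤+ : ∀ {i j} → 0ℤ ≤ i → 0ℤ ≤ j → 0ℤ ≤ i + j
0≤+ = +-mono-≤

0≤+n : ∀ {n} → 0ℤ ≤ + n
0≤+n = +≤+ z≤n

0≤* : ∀ {i j} → 0ℤ ≤ i → 0ℤ ≤ j → 0ℤ ≤ i * j
0≤* {+ m} {+ n} _ _ = subst (0ℤ ≤_) (pos-* m n) 0≤+n

i≤∣i∣ : ∀ i → i ≤ + ∣ i ∣
i≤∣i∣ (+ n) = ≤-refl
i≤∣i∣ -[1+ n ] = ℤ.-≤+

-∣i∣≤i : ∀ i → - (+ ∣ i ∣) ≤ i
-∣i∣≤i (+ n) = neg-≤-pos {n} {n}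
-∣i∣≤i -[1+ n ] = ≤-refl

weight-⊕ : ∀ σ y z → weight σ (y ⊕ z) ≡ weight σ y + weight σ z
weight-⊕ (u , v) (a , b) (c , d) = go a b c d (+ u) (+ v)
  where
  go : ∀ a b c d u v → (a + c) * v - (b + d) * u ≡ a * v - b * u + (c * v - d * u)
  go = solve-∀

weight-⊖ᵛ : ∀ σ y z → weight σ (y ⊖ᵛ z) ≡ weight σ y - weight σ z
weight-⊖ᵛ (u , v) (a , b) (c , d) = go a b c d (+ u) (+ v)
  where
  go : ∀ a b c d u v → (a - c) * v - (b - d) * u ≡ a * v - b * u - (c * v - d * u)
  go = solve-∀

-- Cutting a cycle: when a path returns with displacement `y` to a pair met at `y'`, the effect of
-- the cycle moves into the base point `z`.
rebase : ∀ y y' z → y ⊕ z ≡ y' ⊕ (z ⊕ (y ⊖ᵛ y'))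
rebase (a , b) (a' , b') (c , d) = cong₂ _,_ (go a a' c) (go b b' d)
  where
  go : ∀ a a' c → a + c ≡ a' + (c + (a - a'))
  go = solve-∀

⊕-identityˡ : ∀ z → 𝟎 ⊕ z ≡ z
⊕-identityˡ (a , b) = cong₂ _,_ (+-identityˡ a) (+-identityˡ b)

⊕-swap : ∀ y z d → y ⊕ z ⊕ d ≡ y ⊕ d ⊕ z
⊕-swap (a , b) (c , d) (e , f) = cong₂ _,_ (go a c e) (go b d f)
  where
  go : ∀ a c e → a + c + e ≡ a + e + c
  go = solve-∀

bounded-⊕ : ∀ {k l y z} → Bounded k y → Bounded l z → Bounded (k ℕ.+ l) (y ⊕ z)
bounded-⊕ {y = a , b} {c , d} (p , q) (r , s) =
  ℕₚ.≤-trans (∣i+j∣≤∣i∣+∣j∣ a c) (ℕₚ.+-mono-≤ p r) ,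
  ℕₚ.≤-trans (∣i+j∣≤∣i∣+∣j∣ b d) (ℕₚ.+-mono-≤ q s)

bounded-⊖ᵛ : ∀ {k l y z} → Bounded k y → Bounded l z → Bounded (k ℕ.+ l) (y ⊖ᵛ z)
bounded-⊖ᵛ {y = a , b} {c , d} (p , q) (r , s) =
  ℕₚ.≤-trans (∣i-j∣≤∣i∣+∣j∣ a c) (ℕₚ.+-mono-≤ p r) ,
  ℕₚ.≤-trans (∣i-j∣≤∣i∣+∣j∣ b d) (ℕₚ.+-mono-≤ q s)

bounded-mono : ∀ {k l y} → k ℕ.≤ l → Bounded k y → Bounded l y
bounded-mono k≤l (p , q) = ℕₚ.≤-trans p k≤l , ℕₚ.≤-trans q k≤l

reach : ℕ → ℕ × ℕ → ℕ
reach l (u , v) = l ℕ.* v ℕ.+ l ℕ.* u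

∣weight∣≤ : ∀ {l} σ y → Bounded l y → ∣ weight σ y ∣ ℕ.≤ reach l σ
∣weight∣≤ {l} (u , v) (a , b) (p , q) = begin
  ∣ a * + v - b * + u ∣            ≤⟨ ∣i-j∣≤∣i∣+∣j∣ (a * + v) (b * + u) ⟩
  ∣ a * + v ∣ ℕ.+ ∣ b * + u ∣      ≡⟨ cong₂ ℕ._+_ (abs-* a (+ v)) (abs-* b (+ u)) ⟩
  ∣ a ∣ ℕ.* v ℕ.+ ∣ b ∣ ℕ.* u      ≤⟨ ℕₚ.+-mono-≤ (ℕₚ.*-monoˡ-≤ v p) (ℕₚ.*-monoˡ-≤ u q) ⟩
  l ℕ.* v ℕ.+ l ℕ.* u              ∎
  where open ℕₚ.≤-Reasoning

weight≤reach : ∀ {l} σ y → Bounded l y → weight σ y ≤ + reach l σ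
weight≤reach σ y bd = ≤-trans (i≤∣i∣ _) (+≤+ (∣weight∣≤ σ y bd))

-reach≤weight : ∀ {l} σ y → Bounded l y → - (+ reach l σ) ≤ weight σ y
-reach≤weight σ y bd = ≤-trans (neg-mono-≤ (+≤+ (∣weight∣≤ σ y bd))) (-∣i∣≤i _)

-- Positions, counter effects and enabled rules.

position : ℕ → ℕ → Vector
position m n = + m , + n

effect : Effect → ℤ
effect dec  = -1ℤ
effect stay = 0ℤ
effect inc  = 1ℤ

effects : Effect → Effect → Vector
effects d e = effect d , effect e

bounded-effects : ∀ d e → Bounded 1 (effects d e)
bounded-effects d e = bound d , bound e
  where
  bound : ∀ d → ∣ effect d ∣ ℕ.≤ 1
  bound dec  = s≤s z≤n
  bound stay = z≤n
  bound inc  = s≤s z≤n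

applies⇒ : ∀ e {m n} → Applies e m n → + n ≡ + m + effect e
applies⇒ dec refl = refl
applies⇒ stay {m} refl = sym (+-identityʳ (+ m))
applies⇒ inc {m} refl = cong +_ (ℕₚ.+-comm 1 m)

fire : ∀ e {m} → 1 ℕ.≤ m → ∃ (Applies e m)
fire dec (s≤s {n = m} _) = m , refl
fire stay {m} _ = m , refl
fire inc {m} _ = suc m , refl

-- Ensures that Spoiler's decrements are enabled: with `m` zero the weight `- n * u` cannot be
-- positive.
positive-first : ∀ σ m n → 1ℤ ≤ weight σ (position m n) → 1 ℕ.≤ m
positive-first (u , v) (suc m) n _ = s≤s z≤n
positive-first (u , v) zero n 1≤w = contradiction (≤-trans 1≤w w≤0) λ { (+≤+ ()) }
  where
  w≤0 : weight (u , v) (position 0 n) ≤ 0ℤ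
  w≤0 = ≤-by-difference (0≤* (0≤+n {n}) (0≤+n {u})) (go (+ n) (+ u) (+ v))
    where
    go : ∀ n u v → 0ℤ - (0ℤ * v - n * u) ≡ n * u
    go = solve-∀

negative-second : ∀ σ m n → weight σ (position m n) ≤ -1ℤ → 1 ℕ.≤ n
negative-second (u , v) m (suc n) _ = s≤s z≤n
negative-second (u , v) m zero w≤-1 = contradiction (≤-trans 0≤w w≤-1) λ ()
  where
  0≤w : 0ℤ ≤ weight (u , v) (position m 0)
  0≤w = ≤-by-difference (0≤* (0≤+n {m}) (0≤+n {v})) (go (+ m) (+ u) (+ v))
    where
    go : ∀ m u v → m * v - 0ℤ * u - 0ℤ ≡ m * v
    go = solve-∀

-- Clearing denominators; locating a change of truth value.

∣-∣≤-from-numerators : ∀ v t n d c .{{_ : NonZero d}} → ∣ v * + d - n * t ∣ ℕ.≤ c →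
  ℚ.∣ v ℚ./ 1 ℚ.- t ℚ./ d ℚ.* (n ℚ./ 1) ∣ ℚ.≤ + c ℚ./ 1
∣-∣≤-from-numerators v t n (suc d) c bound = ℚₚ.toℚᵘ-cancel-≤ (begin
  toℚᵘ ℚ.∣ a ℚ.- b ℚ.* e ∣                        ≃⟨ ℚₚ.toℚᵘ-homo-∣-∣ (a ℚ.- b ℚ.* e) ⟩
  ℚᵘ.∣ toℚᵘ (a ℚ.- b ℚ.* e) ∣                     ≃⟨ ℚᵘₚ.∣-∣-cong unnormalise ⟩
  ℚᵘ.∣ mkℚᵘ v 0 ℚᵘ.- mkℚᵘ t d ℚᵘ.* mkℚᵘ n 0 ∣     ≤⟨ *≤* numerators ⟩
  mkℚᵘ (+ c) 0                                    ≃⟨ ℚₚ.toℚᵘ-fromℚᵘ (mkℚᵘ (+ c) 0) ⟨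
  toℚᵘ (+ c ℚ./ 1)                                ∎)
  where
  open ℚᵘₚ.≤-Reasoning
  a = v ℚ./ 1
  b = t ℚ./ suc d
  e = n ℚ./ 1
  unnormalise : toℚᵘ (a ℚ.- b ℚ.* e) ℚᵘ.≃ mkℚᵘ v 0 ℚᵘ.- mkℚᵘ t d ℚᵘ.* mkℚᵘ n 0
  unnormalise = ℚᵘₚ.≃-trans (ℚₚ.toℚᵘ-homo-+ a (ℚ.- (b ℚ.* e)))
    (ℚᵘₚ.+-cong (ℚₚ.toℚᵘ-fromℚᵘ (mkℚᵘ v 0))
      (ℚᵘₚ.≃-trans (ℚₚ.toℚᵘ-homo‿- (b ℚ.* e))
        (ℚᵘₚ.-‿cong (ℚᵘₚ.≃-trans (ℚₚ.toℚᵘ-homo-* b e)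
          (ℚᵘₚ.*-cong (ℚₚ.toℚᵘ-fromℚᵘ (mkℚᵘ t d)) (ℚₚ.toℚᵘ-fromℚᵘ (mkℚᵘ n 0)))))))
  go : ∀ v t n f → v * f - n * t ≡ v * f + - (t * n) * 1ℤ
  go = solve-∀
  -- Over the common denominator the left side is the integer of `bound`; the denominator is at
  -- least 1, so it only enlarges the right side.
  numerators : + ∣ v * + (suc d ℕ.* 1) + - (t * n) * 1ℤ ∣ * 1ℤ ≤ + c * + (1 ℕ.* (suc d ℕ.* 1))
  numerators = ≤-trans (≤-reflexive (*-identityʳ _)) (≤-trans
    (+≤+ (ℕₚ.≤-trans
      (subst (λ x → ∣ x ∣ ℕ.≤ c)
        (trans (go v t n (+ suc d))
          (cong (λ f → v * + f + - (t * n) * 1ℤ) (sym (ℕₚ.*-identityʳ (suc d)))))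
        bound)
      (ℕₚ.m≤m*n c (1 ℕ.* (suc d ℕ.* 1)))))
    (≤-reflexive (pos-* c (1 ℕ.* (suc d ℕ.* 1)))))

switch : ∀ {P : ℕ → Set} → Decidable P → ∀ t → ¬ P 0 → P t → ∃ λ i → i ℕ.< t × ¬ P i × P (suc i)
switch P? zero ¬P0 Pt = contradiction Pt ¬P0
switch P? (suc t) ¬P0 Pt with P? t
... | no ¬Pt = t , ℕₚ.n<1+n t , ¬Pt , Pt
... | yes Pt′ with switch P? t ¬P0 Pt′
... | i , i<t , switches = i , ℕₚ.m<n⇒m<1+n i<t , switches

∣i∣≤-from-bounds : ∀ {i a} → i ≤ + a → - (+ a) ≤ i → ∣ i ∣ ℕ.≤ a
∣i∣≤-from-bounds {+ n} (+≤+ n≤a) _ = n≤a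
∣i∣≤-from-bounds { -[1+ n ]} {a} _ -a≤i =
  drop‿+≤+ (subst (+ suc n ≤_) (neg-involutive (+ a)) (neg-mono-≤ -a≤i))

-- The finite family of directions.

steepest : ℕ → ℕ
steepest l = l ℕ.* l !

-- Index 0 is the vertical direction; the slopes then descend from `l` to 0, reached at index
-- `suc (steepest l)`.
slope : ℕ → ℕ → ℕ × ℕ
slope l zero    = 1 , 0
slope l (suc i) = steepest l ∸ i , l !

∸-step : ∀ {t i} → i ℕ.< t → t ∸ i ≡ suc (t ∸ suc i)
∸-step {t} {i} i<t = trans (cong (_∸ i) (sym (ℕₚ.m+[n∸m]≡n i<t)))
  (trans (cong (_∸ i) (sym (ℕₚ.+-suc i (t ∸ suc i)))) (ℕₚ.m+n∸m≡n i (suc (t ∸ suc i))))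

∣! : ∀ {n l} → suc n ℕ.≤ l → suc n ℕ∣.∣ l !
∣! {n} n<l = ℕ∣.∣-trans (ℕ∣.m∣m*n (n !)) (ℕ∣.m≤n⇒m!∣n! n<l)

0≤+bound : ∀ {l} a → ∣ a ∣ ℕ.≤ l → 0ℤ ≤ a + + l
0≤+bound {l} a a≤l = subst (_≤ a + + l) (+-inverseʳ a)
  (+-monoʳ-≤ a (≤-trans (i≤∣i∣ (- a)) (+≤+ (subst (ℕ._≤ l) (sym (∣-i∣≡∣i∣ a)) a≤l))))

-- No fraction whose denominator is at most l lies strictly between two consecutive
-- multiples of 1 / l !.
weight-next : ∀ l i → i ℕ.≤ steepest l → ∀ y → Bounded l y →
              1ℤ ≤ weight (slope l i) y → 0ℤ ≤ weight (slope l (suc i)) y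
-- Here `b` is at most -1, and slope `l` offsets even the least possible `a`, namely `- l`.
weight-next l zero _ (a , b) (a≤l , _) 1≤w =
  subst (0ℤ ≤_) (trans (go a b (+ l) (+ (l !))) (cong (λ t → a * + (l !) - b * t) (sym (pos-* l (l !)))))
    (0≤+ (0≤* (0≤+n {l !}) (0≤+bound a a≤l))
         (0≤* (0≤* (0≤+n {l}) (0≤+n {l !})) (i≤j⇒0≤j-i 1≤w)))
  where
  go : ∀ a b l f → f * (a + l) + l * f * (a * 0ℤ - b * 1ℤ - 1ℤ) ≡ a * f - b * (l * f)
  go = solve-∀
weight-next l (suc i) i<t (a , + n) _ 1≤w =
  subst (0ℤ ≤_) (go a (+ n) (+ t) (+ (l !)))
    (0≤+ (i≤j⇒0≤j-i 1≤w′) (0≤+n {suc n}))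
  where
  t = steepest l ∸ suc i
  1≤w′ : 1ℤ ≤ a * + (l !) - + n * (1ℤ + + t)
  1≤w′ = subst (λ s → 1ℤ ≤ a * + (l !) - + n * + s) (∸-step i<t) 1≤w
  go : ∀ a n t f → a * f - n * (1ℤ + t) - 1ℤ + (1ℤ + n) ≡ a * f - n * t
  go = solve-∀
-- Now `suc n` divides `l !`, hence the whole weight. Being positive, the weight is at least
-- `suc n`, which is exactly what the next direction subtracts.
weight-next l (suc i) i<t (a , -[1+ n ]) (_ , n<l) 1≤w with ∣! n<l
... | ℕ∣.divides q l!≡q*n =
  subst (0ℤ ≤_) (trans (go₂ a (+ suc n) (+ t) (+ q)) (cong (λ f → a * f - -[1+ n ] * + t) (sym f≡)))
    (0≤* (0≤+n {suc n}) (subst (0ℤ ≤_) (go₃ a (+ t) (+ q)) (i≤j⇒0≤j-i 1≤x)))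
  where
  t = steepest l ∸ suc i
  f≡ : + (l !) ≡ + q * + suc n
  f≡ = trans (cong +_ l!≡q*n) (pos-* q (suc n))
  go₁ : ∀ a b t q → a * (q * b) - - b * (1ℤ + t) ≡ b * (a * q + (1ℤ + t))
  go₁ = solve-∀
  go₂ : ∀ a b t q → b * (a * q + t) ≡ a * (q * b) - - b * t
  go₂ = solve-∀
  go₃ : ∀ a t q → a * q + (1ℤ + t) - 1ℤ ≡ a * q + t
  go₃ = solve-∀
  1≤bx : 1ℤ ≤ + suc n * (a * + q + (1ℤ + + t))
  1≤bx = subst (1ℤ ≤_)
    (trans (cong₂ (λ f s → a * f - -[1+ n ] * + s) f≡ (∸-step i<t)) (go₁ a (+ suc n) (+ t) (+ q))) 1≤w
  1≤x : 1ℤ ≤ a * + q + (1ℤ + + t)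
  1≤x = i<j⇒suc[i]≤j (*-cancelˡ-<-nonNeg (+ suc n)
          (subst (ℤ._< + suc n * (a * + q + (1ℤ + + t))) (sym (*-zeroʳ (+ suc n))) (suc[i]≤j⇒i<j 1≤bx)))

-- Counters are nonnegative, so far below a flatter direction is far below the steeper one. This
-- lets Duplicator switch to her strategy for the steeper one.
weight-previous : ∀ l i → i ℕ.< steepest l → ∀ c → ∃ λ c′ → ∀ m n →
                  weight (slope l (suc i)) (position m n) ≤ - (+ c′) →
                  weight (slope l i) (position m n) ≤ - (+ c)
weight-previous l (suc i) i<t c = c , λ m n w≤ →
  ≤-trans (≤-by-difference (0≤+n {n})
    (trans (cong (λ s → + m * + (l !) - + n * + t - (+ m * + (l !) - + n * + s))
                 (∸-step (ℕₚ.<-trans (ℕₚ.n<1+n i) i<t)))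
      (go (+ m) (+ n) (+ t) (+ (l !))))) w≤
  where
  t = steepest l ∸ suc i
  go : ∀ m n t f → m * f - n * t - (m * f - n * (1ℤ + t)) ≡ n
  go = solve-∀
weight-previous l zero 0<t c = t ℕ.* c , λ m n w≤ →
  ≤-by-difference (i≤j⇒0≤j-i (c≤n m n w≤)) (go₂ (+ m) (+ n) (+ c))
  where
  t = steepest l
  instance
    t-positive : ℤ.Positive (+ t)
    t-positive = ℤ.positive (ℤ.+<+ 0<t)
  go₁ : ∀ m n t c f → t * n - t * c ≡ m * f + (- (t * c) - (m * f - n * t))
  go₁ = solve-∀
  go₂ : ∀ m n c → - c - (m * 0ℤ - n * 1ℤ) ≡ n - c
  go₂ = solve-∀
  c≤n : ∀ m n → weight (t , l !) (position m n) ≤ - (+ (t ℕ.* c)) → + c ≤ + n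
  c≤n m n w≤ = *-cancelˡ-≤-pos (+ c) (+ n) (+ t)
    (≤-by-difference
      (0≤+ (0≤* (0≤+n {m}) (0≤+n {l !}))
           (i≤j⇒0≤j-i (subst (λ s → weight (t , l !) (position m n) ≤ - s) (pos-* t c) w≤)))
      (go₁ (+ m) (+ n) (+ t) (+ c) (+ (l !))))

-- Pigeonhole bound for paths without repetition.

lookup-injective : ∀ {A : Set} {xs : List A} → Unique xs → ∀ i j → lookup xs i ≡ lookup xs j → i ≡ j
lookup-injective (x∉ ∷ u) Fin.zero Fin.zero _ = refl
lookup-injective (x∉ ∷ u) Fin.zero (Fin.suc j) eq = contradiction eq (All.lookup x∉ (∈-lookup j))
lookup-injective (x∉ ∷ u) (Fin.suc i) Fin.zero eq = contradiction (sym eq) (All.lookup x∉ (∈-lookup i))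
lookup-injective (x∉ ∷ u) (Fin.suc i) (Fin.suc j) eq = cong Fin.suc (lookup-injective u i j eq)

unique-length : ∀ {k l} {xs : List (Fin k × Fin l)} → Unique xs → length xs ℕ.≤ k ℕ.* l
unique-length {k} {l} {xs} u = Finₚ.injective⇒≤ {f = λ i → Fin.combine (proj₁ (lookup xs i)) (proj₂ (lookup xs i))}
  λ {i} {j} eq → lookup-injective u i j
    (case Finₚ.combine-injective _ _ _ _ eq of λ (p , q) → cong₂ _,_ p q)

-- The finite cycle game.

module Game (N : OCN) where
  open OCN N

  -- The vector of an entry is the displacement of the two counters since the start of the
  -- path; a list of entries is a path, latest entry first.
  State Entry : Set
  State = Fin nQ × Fin nQ
  Entry = State × Vector

  nStates : ℕ
  nStates = nQ ℕ.* nQ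

  _≟ˢ_ : (s t : State) → Dec (s ≡ t)
  _≟ˢ_ = ≡-dec Fin._≟_ Fin._≟_

  -- Counter values are ignored here. Quantifying over the list `δ` keeps the notion decidable.
  Answers : (Entry → Set) → Entry → Set
  Answers W ((p , q) , y) =
    All (λ (p₀ , a , d , p′) → p₀ ≡ p →
      Any (λ (q₀ , b , e , q′) → (q₀ ≡ q × b ≡ a) × W ((p′ , q′) , y ⊕ effects d e)) δ) δ

  answers? : ∀ {W} → Decidable W → Decidable (Answers W)
  answers? W? ((p , q) , y) =
    All.all? (λ (p₀ , a , d , p′) → (p₀ Fin.≟ p) →-dec
      Any.any? (λ (q₀ , b , e , q′) → ((q₀ Fin.≟ q) ×-dec (b Fin.≟ a)) ×-dec W? _) δ) δ

  Repeats : Entry → Entry → Set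
  Repeats (s , _) (s′ , _) = s′ ≡ s

  module Cycles (Done : State → Set) (σ : ℕ × ℕ) where

    Closes : Entry → Entry → Set
    Closes (s , y) (s′ , y′) = s′ ≡ s × weight σ y ≤ weight σ y′

    -- `k` is fuel, and exhausting it is a loss for Duplicator. The initial `suc nStates` admits one
    -- pair more than there are, which forces a repetition.
    Safe : ℕ → List Entry → Entry → Set
    Safe zero    h e = ⊥
    Safe (suc k) h e = Done (proj₁ e) ⊎ Any (Closes e) h ⊎ Answers (Safe k (e ∷ h)) e

    safe? : Decidable Done → ∀ k h → Decidable (Safe k h)
    safe? done? zero h e = no λ ()
    safe? done? (suc k) h e@(s , y) =
      done? s ⊎-dec Any.any? (λ (s′ , y′) → (s′ ≟ˢ s) ×-dec (weight σ y ≤? weight σ y′)) h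
        ⊎-dec answers? (safe? done? k (e ∷ h)) e

  -- Each entry stores the fuel left after it and the winner's invariant, so that play can resume
  -- there once a later cycle is cut out.
  Kept : (ℕ → List Entry → Entry → Set) → List Entry → Entry → Set
  Kept G h e = Σ ℕ λ k → k ℕ.+ length h ≡ nStates × Bounded (length h) (proj₂ e) × G k h e

  History : (ℕ → List Entry → Entry → Set) → List Entry → Set
  History G []      = ⊤
  History G (e ∷ h) = Kept G h e × History G h

  rewind : ∀ {G h} {P : Entry → Set} → History G h → Any P h →
           Σ Entry λ e → Σ (List Entry) λ h′ → P e × Kept G h′ e × History G h′
  rewind {h = e ∷ h} (g , hist) (here p)  = e , h , p , g , hist
  rewind (_ , hist) (there any) = rewind hist any

  length≤ : ∀ {k} {h : List Entry} → k ℕ.+ length h ≡ nStates → length h ℕ.≤ nStates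
  length≤ {k} {h} eq = subst (length h ℕ.≤_) eq (ℕₚ.m≤n+m (length h) k)

  extend-bounded : ∀ (h : List Entry) {y} → Bounded (length h) y → ∀ d e → Bounded (suc (length h)) (y ⊕ effects d e)
  extend-bounded h {y} b d e = subst (λ l → Bounded l (y ⊕ effects d e)) (ℕₚ.+-comm (length h) 1)
    (bounded-⊕ {y = y} b (bounded-effects d e))

  move-position : ∀ {d e m n m′ n′ y z} → Applies d m m′ → Applies e n n′ →
                  position m n ≡ y ⊕ z → position m′ n′ ≡ y ⊕ effects d e ⊕ z
  move-position {d} {e} {y = y} {z} am an eq =
    trans (cong₂ _,_ (applies⇒ d am) (applies⇒ e an))
      (trans (cong (_⊕ effects d e) eq) (⊕-swap y z (effects d e)))

  -- From a win in the cycle game to a simulation.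

  module Duplicator
    (Done : State → Set) (σ : ℕ × ℕ)
    (Sim : Config N → Config N → Set) (sim : IsSimulation N Sim) (c₀ : ℕ)
    (covers : ∀ {p q} → Done (p , q) → ∀ m n → weight σ (position m n) ≤ - (+ c₀) → Sim (p , m) (q , n))
    where
    open Cycles Done σ

    ReadyToAnswer : ℕ → List Entry → Entry → Set
    ReadyToAnswer k h e = Answers (Safe k (e ∷ h)) e

    -- The tracked path shifts the weight by at most `radius`; the remaining `suc c₀` permits the
    -- handover to `Sim` and keeps Duplicator's counter positive.
    radius margin : ℕ
    radius = reach nStates σ
    margin = suc c₀ ℕ.+ radius

    -- y is the displacement along the current simple path and z the position at its start,
    -- which absorbs the effects of all cycles closed so far.
    Tracks : Config N → Config N → Set
    Tracks (p , m) (q , n) =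
      Σ (List Entry) λ h → Σ Vector λ y → Σ Vector λ z →
        Kept ReadyToAnswer h ((p , q) , y) × History ReadyToAnswer h ×
        position m n ≡ y ⊕ z × weight σ z ≤ - (+ margin)

    Extended : Config N → Config N → Set
    Extended s t = Sim s t ⊎ Tracks s t

    far : ∀ m n y z → Bounded nStates y → position m n ≡ y ⊕ z → weight σ z ≤ - (+ margin) →
          weight σ (position m n) ≤ - (+ suc c₀)
    far m n y z bd eq w≤ = begin
      weight σ (position m n)            ≡⟨ cong (weight σ) eq ⟩
      weight σ (y ⊕ z)                   ≡⟨ weight-⊕ σ y z ⟩
      weight σ y + weight σ z            ≤⟨ +-mono-≤ (weight≤reach σ y bd) w≤ ⟩
      + radius - (+ margin)              ≡⟨ cong (_-_ (+ radius)) (pos-+ (suc c₀) radius) ⟩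
      + radius - (+ suc c₀ + + radius)   ≡⟨ go (+ radius) (+ suc c₀) ⟩
      - (+ suc c₀)                       ∎
      where
      open ≤-Reasoning
      go : ∀ r c → r - (c + r) ≡ - c
      go = solve-∀

    -- One case per way of being `Safe`: hand over to `Sim`, resume at the earlier occurrence with
    -- the weight of `z` not raised, or await Spoiler's move.
    arrive : ∀ {p q m n} k h y z → Safe k h ((p , q) , y) →
             k ℕ.+ length h ≡ suc nStates → Bounded (length h) y → History ReadyToAnswer h →
             position m n ≡ y ⊕ z → weight σ z ≤ - (+ margin) → Extended (p , m) (q , n)
    arrive {m = m} {n} (suc k) h y z (inj₁ d) len bd hist eq w≤ =
      inj₁ (covers d m n (≤-trans
        (far m n y z (bounded-mono {y = y} (length≤ {k} {h} (ℕₚ.suc-injective len)) bd) eq w≤)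
        (neg-mono-≤ (+≤+ (ℕₚ.n≤1+n c₀)))))
    arrive (suc k) h y z (inj₂ (inj₁ cl)) len bd hist eq w≤ with rewind hist cl
    ... | (_ , y′) , h′ , (refl , w≤′) , kept , hist′ =
      inj₂ (h′ , y′ , z ⊕ (y ⊖ᵛ y′) , kept , hist′ , trans eq (rebase y y′ z) , w≤″)
      where
      w≤″ : weight σ (z ⊕ (y ⊖ᵛ y′)) ≤ - (+ margin)
      w≤″ = subst₂ _≤_
              (sym (trans (weight-⊕ σ z (y ⊖ᵛ y′)) (cong (_+_ (weight σ z)) (weight-⊖ᵛ σ y y′))))
              (+-identityʳ (- (+ margin)))
              (+-mono-≤ w≤ (i≤j⇒i-j≤0 w≤′))
    arrive (suc k) h y z (inj₂ (inj₂ ans)) len bd hist eq w≤ =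
      inj₂ (h , y , z , (k , ℕₚ.suc-injective len , bd , ans) , hist , eq , w≤)

    extended-isSimulation : IsSimulation N Extended
    extended-isSimulation s t (inj₁ r) a s′ step with sim s t r a s′ step
    ... | t′ , step′ , r′ = t′ , step′ , inj₁ r′
    extended-isSimulation (p , m) (q , n) (inj₂ (h , y , z , kept@(k , len , bd , ans) , hist , eq , w≤))
                          a (p′ , m′) (d , r∈δ , am)
      with find (All.lookup ans r∈δ refl)
    ... | (_ , _ , e , q′) , r′∈δ , (refl , refl) , safe =
      let n′ , an = fire e (negative-second σ m n
                      (≤-trans (far m n y z (bounded-mono {y = y} (length≤ {k} {h} len) bd) eq w≤)
                               (neg-mono-≤ (+≤+ (s≤s z≤n)))))
      in (q′ , n′) , (e , r′∈δ , an) ,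
         arrive k (_ ∷ h) (y ⊕ effects d e) z safe (trans (ℕₚ.+-suc k (length h)) (cong suc len))
           (extend-bounded h {y} bd d e) (kept , hist) (move-position {d} {e} {y = y} {z} am an eq) w≤

    extended-covers : ∀ {p q} → Safe (suc nStates) [] ((p , q) , 𝟎) → ∀ m n →
                      weight σ (position m n) ≤ - (+ margin) → Extended (p , m) (q , n)
    extended-covers safe m n = arrive (suc nStates) [] 𝟎 (position m n) safe (ℕₚ.+-identityʳ _)
      (z≤n , z≤n) tt (sym (⊕-identityˡ (position m n)))

  -- From a loss in the cycle game to a refutation of simulation.

  module Spoiler
    (Done : State → Set) (done? : Decidable Done) (σ τ : ℕ × ℕ)
    (cycle : ∀ y → Bounded (nStates ℕ.+ nStates) y → 1ℤ ≤ weight σ y → 0ℤ ≤ weight τ y)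
    (Sim : Config N → Config N → Set) (sim : IsSimulation N Sim) (c₀ : ℕ)
    (wins : ∀ {p q} → ¬ Done (p , q) → ∀ m n → + c₀ ≤ weight σ (position m n) → ¬ Sim (p , m) (q , n))
    where
    open Cycles Done σ

    Losing : ℕ → List Entry → Entry → Set
    Losing k h e = ¬ Safe (suc k) h e × All (¬_ ∘ Repeats e) h

    -- Both allow for the displacement `y`: at the target the position itself has `σ`-weight at
    -- least `c₀`, and its `τ`-weight stays at least 1, so Spoiler can move.
    target margin : ℕ
    target = c₀ ℕ.+ reach nStates σ
    margin = suc (reach nStates τ)

    unique : ∀ {h} → History Losing h → Unique (map proj₁ h)
    unique {[]} _ = []
    unique {e ∷ h} ((_ , _ , _ , _ , fresh) , hist) = All-map⁺ (All.map (_∘ sym) fresh) ∷ unique hist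

    short : ∀ {h} → History Losing h → length h ℕ.≤ nStates
    short {h} hist = subst (ℕ._≤ nStates) (length-map proj₁ h) (unique-length (unique hist))

    refuted : ∀ {W} p q y → Decidable W → ¬ Answers W ((p , q) , y) →
      Σ (Fin nQ × Fin nA × Effect × Fin nQ) λ (p₀ , a , d , p′) →
        (p₀ , a , d , p′) ∈ δ × p₀ ≡ p ×
        (∀ {e′ q′} → (q , a , e′ , q′) ∈ δ → ¬ W ((p′ , q′) , y ⊕ effects d e′))
    refuted {W} p q y W? ¬ans with find (¬All⇒Any¬ (λ (p₀ , a , d , p′) → (p₀ Fin.≟ p) →-dec
      Any.any? (λ (q₀ , b , e , q′) → ((q₀ Fin.≟ q) ×-dec (b Fin.≟ a)) ×-dec W? _) δ) δ ¬ans)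
    ... | r@(p₀ , a , d , p′) , r∈δ , ¬imp with p₀ Fin.≟ p
    ... | yes refl = r , r∈δ , refl , λ r′∈δ w → ¬imp λ _ → lose r′∈δ ((refl , refl) , w)
    ... | no p₀≢p = contradiction (λ p₀≡p → contradiction p₀≡p p₀≢p) ¬imp

    lower : ∀ {l} ρ m n y z c → Bounded l y → position m n ≡ y ⊕ z →
            + (c ℕ.+ reach l ρ) ≤ weight ρ z → + c ≤ weight ρ (position m n)
    lower {l} ρ m n y z c bd eq ≤w = begin
      + c                                       ≡⟨ go (+ reach l ρ) (+ c) ⟨
      - (+ reach l ρ) + (+ c + + reach l ρ)     ≡⟨ cong (_+_ (- (+ reach l ρ))) (pos-+ c (reach l ρ)) ⟨
      - (+ reach l ρ) + + (c ℕ.+ reach l ρ)     ≤⟨ +-mono-≤ (-reach≤weight ρ y bd) ≤w ⟩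
      weight ρ y + weight ρ z                   ≡⟨ weight-⊕ ρ y z ⟨
      weight ρ (y ⊕ z)                          ≡⟨ cong (weight ρ) eq ⟨
      weight ρ (position m n)                   ∎
      where
      open ≤-Reasoning
      go : ∀ r c → - r + (c + r) ≡ c
      go = solve-∀

    -- A play against Sim that Spoiler is steering.  The position is split as in Tracks, and
    -- at most g more cycles can close before the target weight is reached.
    record Play (g k : ℕ) : Set where
      field
        {p q}    : Fin nQ
        {m n}    : ℕ
        h        : List Entry
        y z      : Vector
        len      : k ℕ.+ length h ≡ nStates
        bounded  : Bounded (length h) y
        losing   : Losing k h ((p , q) , y)
        history  : History Losing h
        splits   : position m n ≡ y ⊕ z
        σ-margin : + target ≤ weight σ z + + g
        τ-margin : + margin ≤ weight τ z
        related  : Sim (p , m) (q , n)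

      entry : Entry
      entry = (p , q) , y

      history⁺ : History Losing (entry ∷ h)
      history⁺ = (k , len , bounded , losing) , history

      bounded⁺ : Bounded nStates y
      bounded⁺ = bounded-mono {y = y} (length≤ {k} {h} len) bounded

    -- The cycle violates `Closes`, so its `σ`-weight is at least 1 and pays for one unit of `g`; by
    -- `cycle` its `τ`-weight is nonnegative, so `τ-margin` survives.
    close-cycle : ∀ {g k p q m n} h y y″ z →
                  k ℕ.+ length h ≡ nStates → Bounded (length h) y″ → Losing k h ((p , q) , y″) →
                  History Losing h → Bounded nStates y → position m n ≡ y ⊕ z →
                  ¬ weight σ y ≤ weight σ y″ →
                  + target ≤ weight σ z + + suc g → + margin ≤ weight τ z → Sim (p , m) (q , n) → Play g k
    close-cycle {g} {k} h y y″ z len bd losing hist bdy eq w≰ ≤σ ≤τ rel = record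
      { h = h ; y = y″ ; z = z ⊕ v ; len = len ; bounded = bd ; losing = losing ; history = hist
      ; splits = trans eq (rebase y y″ z)
      ; σ-margin = ≤-trans ≤σ (≤-by-difference (i≤j⇒0≤j-i 1≤v)
          (trans (cong (λ w → w + + g - (weight σ z + + suc g)) (weight-⊕ σ z v))
                 (go₂ (weight σ z) (weight σ v) (+ g))))
      ; τ-margin = ≤-trans ≤τ (≤-by-difference (cycle v bdv 1≤v)
          (trans (cong (_- weight τ z) (weight-⊕ τ z v)) (go₃ (weight τ z) (weight τ v))))
      ; related = rel }
      where
      v : Vector
      v = y ⊖ᵛ y″
      go₁ : ∀ a b → a - b - 1ℤ ≡ a - (1ℤ + b)
      go₁ = solve-∀
      go₂ : ∀ a b g → a + b + g - (a + (1ℤ + g)) ≡ b - 1ℤ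
      go₂ = solve-∀
      go₃ : ∀ a b → a + b - a ≡ b
      go₃ = solve-∀
      1≤v : 1ℤ ≤ weight σ v
      1≤v = subst (1ℤ ≤_) (sym (weight-⊖ᵛ σ y y″))
        (≤-by-difference (i≤j⇒0≤j-i (i<j⇒suc[i]≤j (≰⇒> w≰))) (go₁ (weight σ y) (weight σ y″)))
      bdv : Bounded (nStates ℕ.+ nStates) v
      bdv = bounded-⊖ᵛ {y = y} {y″} bdy (bounded-mono {y = y″} (length≤ {k} {h} len) bd)

    module _ {g k} (play : Play (suc g) (suc k)) where
      open Play play

      -- Spoiler plays a rule without safe answer and `Sim` must reply. A new pair costs fuel; a
      -- repeated one closes a cycle.
      round : Play (suc g) k ⊎ ∃ (Play g)
      round with refuted p q y (safe? done? (suc k) (entry ∷ h)) (proj₁ losing ∘ inj₂ ∘ inj₂)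
      ... | (_ , a , d , p′) , r∈δ , refl , no-answer
        with fire d (positive-first τ m n (lower τ m n y z 1 bounded⁺ splits τ-margin))
      ... | m′ , am with sim _ _ related a (p′ , m′) (d , r∈δ , am)
      ... | (q′ , n′) , (e , r′∈δ , an) , related′
        with Any.any? (λ (s , _) → s ≟ˢ (p′ , q′)) (entry ∷ h)
      ... | no new = inj₁ record
        { h = entry ∷ h ; y = y ⊕ effects d e ; z = z
        ; len = trans (ℕₚ.+-suc k (length h)) len ; bounded = extend-bounded h {y} bounded d e
        ; losing = no-answer r′∈δ , ¬Any⇒All¬ _ new ; history = history⁺
        ; splits = move-position {d} {e} {y = y} {z} am an splits
        ; σ-margin = σ-margin ; τ-margin = τ-margin ; related = related′ }
      ... | yes old with find old
      ... | (_ , y″) , e∈h , refl with rewind history⁺ e∈h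
      ... | _ , h″ , refl , (k″ , len″ , bd″ , losing″) , hist″ =
        inj₂ (k″ , close-cycle h″ (y ⊕ effects d e) y″ z len″ bd″ losing″ hist″
          (bounded-mono {y = y ⊕ effects d e} (subst (suc (length h) ℕ.≤_) len (s≤s (ℕₚ.m≤n+m (length h) k)))
            (extend-bounded h {y} bounded d e))
          (move-position {d} {e} {y = y} {z} am an splits)
          (λ w≤ → no-answer r′∈δ (inj₂ (inj₁ (lose e∈h (refl , w≤)))))
          σ-margin τ-margin related′)

    -- Lexicographic descent: closing a cycle may restore `k` but lowers `g`.
    no-play : ∀ g k → ¬ Play g k
    no-play zero k play = wins (proj₁ losing ∘ inj₁) m n
      (lower σ m n y z c₀ bounded⁺ splits (subst (+ target ≤_) (+-identityʳ _) σ-margin)) related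
      where open Play play
    -- Without fuel the path would visit `suc nStates` distinct pairs.
    no-play (suc g) zero play =
      contradiction (short {entry ∷ h} history⁺) (ℕₚ.<⇒≱ (ℕₚ.≤-reflexive (cong suc (sym len))))
      where open Play play
    no-play (suc g) (suc k) play = [ no-play (suc g) k , (λ (k″ , play″) → no-play g k″ play″) ]′ (round play)

    attack : ∀ {p q} → ¬ Safe (suc nStates) [] ((p , q) , 𝟎) → ∀ m n →
             + margin ≤ weight τ (position m n) → ¬ Sim (p , m) (q , n)
    attack {p} {q} ¬safe m n ≤τ rel = no-play ∣ + target - w ∣ nStates record
      { h = [] ; y = 𝟎 ; z = position m n ; len = ℕₚ.+-identityʳ _ ; bounded = z≤n , z≤n
      ; losing = ¬safe , [] ; history = tt ; splits = sym (⊕-identityˡ (position m n))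
      ; σ-margin = ≤-by-difference (i≤j⇒0≤j-i (i≤∣i∣ (+ target - w))) (go (+ target) w (+ ∣ + target - w ∣))
      ; τ-margin = ≤τ ; related = rel }
      where
      w = weight σ (position m n)
      go : ∀ t w g → w + g - t ≡ g - (t - w)
      go = solve-∀

-- Induction over the directions.

module Regions (N : OCN) where
  open OCN N
  open Game N

  -- The effect of a cycle is a difference of two displacements, each bounded by `nStates`.
  width : ℕ
  width = nStates ℕ.+ nStates

  direction : ℕ → ℕ × ℕ
  direction = slope width

  -- Region (suc i) consists of the pairs from which Duplicator wins below the i-th direction.
  Region : ℕ → State → Set
  Region zero    s = ⊥
  Region (suc i) s = Cycles.Safe (Region i) (direction i) (suc nStates) [] (s , 𝟎)

  region? : ∀ i → Decidable (Region i)
  region? zero    s = no λ ()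
  region? (suc i) s = Cycles.safe? (Region i) (direction i) (region? i) (suc nStates) [] (s , 𝟎)

  -- No position is above the vertical direction. In the step, Spoiler gains weight for direction
  -- `i` until the induction hypothesis applies, without falling below direction `suc i`.
  spoiler-wins : ∀ i → i ℕ.≤ suc (steepest width) → ∃ λ c → ∀ {p q} → ¬ Region i (p , q) → ∀ m n →
                 + c ≤ weight (direction i) (position m n) → ¬ _≼_ N (p , m) (q , n)
  spoiler-wins zero _ = 1 , λ _ m n 1≤w _ →
    contradiction (≤-trans 1≤w (w≤0 m n)) λ { (+≤+ ()) }
    where
    w≤0 : ∀ m n → weight (direction 0) (position m n) ≤ 0ℤ
    w≤0 m n = ≤-by-difference (0≤+n {n}) (go (+ m) (+ n))
      where
      go : ∀ m n → 0ℤ - (m * 0ℤ - n * 1ℤ) ≡ n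
      go = solve-∀
  spoiler-wins (suc i) (s≤s i≤t) with spoiler-wins i (ℕₚ.m≤n⇒m≤1+n i≤t)
  ... | c , wins = suc (reach nStates (direction (suc i))) , λ losing m n c≤w (Sim , sim , rel) →
    Spoiler.attack (Region i) (region? i) (direction i) (direction (suc i)) (weight-next width i i≤t)
      Sim sim c (λ out m n c≤w r → wins out m n c≤w (Sim , sim , r)) losing m n c≤w rel

  -- An explicit simulation is carried along, since `_≼_` lives in `Set₁` and cannot be the relation
  -- to extend. The start is the empty relation.
  duplicator-simulation : ∀ i → i ℕ.≤ steepest width →
    ∃ λ c → Σ (Config N → Config N → Set) λ Sim → IsSimulation N Sim ×
      (∀ {p q} → Region (suc i) (p , q) → ∀ m n →
       weight (direction i) (position m n) ≤ - (+ c) → Sim (p , m) (q , n))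
  duplicator-simulation zero _ = _ , Extended , extended-isSimulation , extended-covers
    where open Duplicator (Region 0) (direction 0) (λ _ _ → ⊥) (λ _ _ ()) 0 (λ ())
  duplicator-simulation (suc i) i<t with duplicator-simulation i (ℕₚ.<⇒≤ i<t)
  ... | c , Sim , sim , covers with weight-previous width i i<t c
  ... | c′ , previous = _ , Extended , extended-isSimulation , extended-covers
    where open Duplicator (Region (suc i)) (direction (suc i)) Sim sim c′
                 (λ done m n w≤ → covers done m n (previous m n w≤))

  duplicator-wins : ∀ i → i ℕ.≤ steepest width → ∃ λ c → ∀ {p q} → Region (suc i) (p , q) → ∀ m n →
                    weight (direction i) (position m n) ≤ - (+ c) → _≼_ N (p , m) (q , n)
  duplicator-wins i i≤t with duplicator-simulation i i≤t
  ... | c , Sim , sim , covers = c , λ safe m n w≤ → Sim , sim , covers safe m n w≤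

-- Reading off the frontier function.

module Frontier (N : OCN) (p q : Fin (OCN.nQ N)) (f : ℕ → ExtVal N)
  (frontier : FrontierFunction N p q f) where
  open Game N
  open Regions N

  -- The vertical weight is `- n`, so one large `n` serves every `m`.
  f-infinite : Region 1 (p , q) → ∃ λ n → f n ≡ infty
  f-infinite region with duplicator-wins 0 z≤n
  ... | c , wins with f c in fc | frontier c
  ... | infty | _ = c , fc
  ... | fin k | _ , maximal =
    contradiction (maximal (suc k) (wins region (suc k) c (≤-reflexive (go (+ suc k) (+ c))))) ℕₚ.1+n≰n
    where
    go : ∀ m n → m * 0ℤ - n * 1ℤ ≡ - n
    go = solve-∀
  ... | minus1 | fails = contradiction (wins region 0 c (≤-reflexive (go (+ c)))) fails
    where
    go : ∀ n → 0ℤ * 0ℤ - n * 1ℤ ≡ - n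
    go = solve-∀

  -- The last direction is horizontal: its weight ignores `n`, so Spoiler wins beyond a fixed value
  -- of his counter.
  f-bounded : (∀ n → f n ≢ infty) → ¬ Region (suc (steepest width)) (p , q) →
              Σ ℕ λ c → ∀ n → _<ₑ_ N (f n) c
  f-bounded finite out with spoiler-wins (suc (steepest width)) ℕₚ.≤-refl
  ... | c , wins = c , bounded
    where
    flat : ∀ k n → c ℕ.≤ k → + c ≤ weight (direction (suc (steepest width))) (position k n)
    flat k n c≤k = begin
      + c                                        ≤⟨ +≤+ (ℕₚ.≤-trans c≤k (ℕₚ.m≤m*n k (width !) {{width ℕₚ.!≢0}})) ⟩
      + (k ℕ.* width !)                          ≡⟨ pos-* k (width !) ⟩
      + k * + (width !)                          ≡⟨ go (+ k) (+ n) (+ (width !)) ⟩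
      + k * + (width !) - + n * 0ℤ               ≡⟨ cong (λ t → + k * + (width !) - + n * + t) (ℕₚ.n∸n≡0 (steepest width)) ⟨
      weight (direction (suc (steepest width))) (position k n) ∎
      where
      open ≤-Reasoning
      go : ∀ k n m → k * m ≡ k * m - n * 0ℤ
      go = solve-∀
    bounded : ∀ n → _<ₑ_ N (f n) c
    bounded n with f n | frontier n | finite n
    ... | infty | _ | f≢∞ = contradiction refl f≢∞
    ... | minus1 | _ | _ = tt
    ... | fin k | k≼ , _ | _ = ℕₚ.≰⇒> λ c≤k → wins out k n (flat k n c≤k) k≼

  -- Spoiler wins far above direction `suc i` and Duplicator far below it, which confines the
  -- frontier to a strip. Its slope is positive by `i<t`.
  f-linear : (∀ n → f n ≢ infty) → ∀ i → i ℕ.< steepest width →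
             ¬ Region (suc i) (p , q) → Region (suc (suc i)) (p , q) →
             Σ ℚ λ α → Positive α × (Σ ℕ λ c → ∀ n → DistLe N (f n) α n c)
  f-linear finite i i<t out region
    with spoiler-wins (suc i) (s≤s (ℕₚ.<⇒≤ i<t)) | duplicator-wins (suc i) i<t
  ... | cₛ , above | c_d , below =
    + t ℚ./ d , ℚₚ.normalize-pos t d , cₛ ℕ.+ (c_d ℕ.+ d) , distance
    where
    t d c : ℕ
    t = steepest width ∸ i
    d = width !
    c = cₛ ℕ.+ (c_d ℕ.+ d)
    instance
      t-nonZero : NonZero t
      t-nonZero = ℕ.≢-nonZero (ℕₚ.m>n⇒m∸n≢0 i<t)
      d-nonZero : NonZero d
      d-nonZero = width ℕₚ.!≢0
    c≡ : + c ≡ + cₛ + (+ c_d + + d)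
    c≡ = trans (pos-+ cₛ (c_d ℕ.+ d)) (cong (_+_ (+ cₛ)) (pos-+ c_d d))
    upper : ∀ k n → _≼_ N (p , k) (q , n) → + k * + d - + n * + t ≤ + c
    upper k n k≼ = ≤-trans (<⇒≤ (≰⇒> λ c≤w → above out k n c≤w k≼)) (+≤+ (ℕₚ.m≤m+n cₛ (c_d ℕ.+ d)))
    -- Simulation fails one above the frontier; passing to `k - 1` costs the `d` in `c`. The value
    -- -1 is the case of `k` zero.
    lower : ∀ k n → ¬ _≼_ N (p , k) (q , n) → - (+ c) ≤ (+ k - 1ℤ) * + d - + n * + t
    lower k n k⋠ = ≤-by-difference
      (0≤+ (i≤j⇒0≤j-i (<⇒≤ (≰⇒> λ w≤ → k⋠ (below region k n w≤)))) (0≤+n {cₛ}))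
      (trans (cong (λ x → (+ k - 1ℤ) * + d - + n * + t - - x) c≡)
        (go (+ k) (+ n) (+ d) (+ t) (+ cₛ) (+ c_d)))
      where
      go : ∀ k n d t a b → (k - 1ℤ) * d - n * t - - (a + (b + d)) ≡ k * d - n * t - - b + a
      go = solve-∀
    distance : ∀ n → DistLe N (f n) (+ t ℚ./ d) n c
    distance n with f n | frontier n | finite n
    ... | infty | _ | f≢∞ = f≢∞ refl
    ... | fin k | k≼ , maximal | _ = ∣-∣≤-from-numerators (+ k) (+ t) (+ n) d c
      (∣i∣≤-from-bounds (upper k n k≼) (lower (suc k) n (ℕₚ.1+n≰n ∘ maximal (suc k))))
    ... | minus1 | 0⋠ | _ = ∣-∣≤-from-numerators -1ℤ (+ t) (+ n) d c
      (∣i∣≤-from-bounds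
        (≤-by-difference (0≤+ (0≤+n {c}) (0≤+ (0≤+n {d}) (0≤* (0≤+n {n}) (0≤+n {t}))))
          (go (+ n) (+ t) (+ d) (+ c)))
        (lower 0 n 0⋠))
      where
      go : ∀ n t d c → c - (-1ℤ * d - n * t) ≡ c + (d + n * t)
      go = solve-∀

theorem4 : (N : OCN) (p q : Fin (OCN.nQ N)) (f : ℕ → ExtVal N) →
    FrontierFunction N p q f →
    (∀ n → f n ≢ infty) →
    ¬ (Σ ℕ λ c → ∀ n → _<ₑ_ N (f n) c) →
    Σ ℚ λ α → Positive α × (Σ ℕ λ c → ∀ n → DistLe N (f n) α n c)
theorem4 N p q f frontier finite unbounded =
  -- Finiteness excludes a win for Duplicator at the vertical direction; unboundedness forces one at
  -- the horizontal, decidability removing the double negation.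
  let i , i<t , out , region = switch (λ i → region? (suc i) (p , q)) (steepest width)
        (λ region → let n , fn≡∞ = f-infinite region in finite n fn≡∞)
        (decidable-stable (region? (suc (steepest width)) (p , q)) (unbounded ∘ f-bounded finite))
  in f-linear finite i i<t out region
  where
  open Regions N
  open Frontier N p q f frontier
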